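{- Let $\mathbf u$ be an infinite word over a finite alphabet whose language is closed under reversal. Suppose that both the defect $D(\mathbf u)$ and the sum $\sum_{n=0}^{+\infty}T_{\mathbf u}(n)$ are finite. Then $$2D(\mathbf u)=\sum_{n=0}^{+\infty}T_{\mathbf u}(n).$$
   Context: For a finite word $w=w_0\cdots w_{n-1}$ its reversal is $\overline{w}=w_{n-1}\cdots w_0$; $w$ is a palindrome if $w=\overline{w}$ (the empty word is a palindrome). The language $\mathcal L(\mathbf u)$ of an infinite word $\mathbf u$ is the set of its finite factors, $\mathcal L_n(\mathbf u)$ those of length $n$; the language is closed under reversal if $w\in\mathcal L(\mathbf u)$ implies $\overline{w}\in\mathcal L(\mathbf u)$. The defect of a finite word $w$ is $D(w)=|w|+1-(\text{number of distinct palindromic factors of } w, \text{ including the empty word})$. The defect of an infinite word is $D(\mathbf u)=\sup\{D(w): w \text{ a prefix of } \mathbf u\}$ (possibly $+\infty$). The factor complexity is $\mathcal C_{\mathbf u}(n)=\#\mathcal L_n(\mathbf u)$, the palindromic complexity $\mathcal P_{\mathbf u}(n)$ is the number of palindromes in $\mathcal L_n(\mathbf u)$, and $T_{\mathbf u}(n)=\mathcal C_{\mathbf u}(n+1)-\mathcal C_{\mathbf u}(n)+2-\mathcal P_{\mathbf u}(n+1)-\mathcal P_{\mathbf u}(n)$. -}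

module Defs where

open import Data.Nat using (ℕ; zero; suc; _+_; _∸_)
open import Data.Fin using (Fin)
import Data.Fin as Fin
open import Data.List using (List; []; _∷_; length; map; concatMap; upTo; applyUpTo; take; drop; reverse; filter; deduplicate)
open import Data.List.Properties using (≡-dec)
open import Data.List.Membership.Propositional using (_∈_)
open import Data.List.Relation.Unary.Unique.Propositional using (Unique)
open import Data.Integer using (ℤ; +_; _-_) renaming (_+_ to _+ℤ_)
open import Data.Product using (Σ; ∃; ∃-syntax; _×_)
open import Function.Bundles using (_⇔_)
open import Relation.Binary.PropositionalEquality using (_≡_)
open import Relation.Nullary using (Dec)

Word : ℕ → Set
Word k = ℕ → Fin k

FWord : ℕ → Set
FWord k = List (Fin k)

_≟w_ : ∀ {k} (v w : FWord k) → Dec (v ≡ w)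
_≟w_ = ≡-dec Fin._≟_

factorAt : ∀ {k} → Word k → ℕ → ℕ → FWord k
factorAt u i n = applyUpTo (λ j → u (i + j)) n

prefix : ∀ {k} → Word k → ℕ → FWord k
prefix u n = factorAt u 0 n

InLang : ∀ {k} → Word k → FWord k → Set
InLang u w = ∃[ i ] factorAt u i (length w) ≡ w

InLangN : ∀ {k} → Word k → ℕ → FWord k → Set
InLangN u n w = (length w ≡ n) × InLang u w

IsPalindrome : ∀ {k} → FWord k → Set
IsPalindrome w = w ≡ reverse w

ClosedUnderReversal : ∀ {k} → Word k → Set
ClosedUnderReversal u = ∀ w → InLang u w → InLang u (reverse w)

IsCard : ∀ {k} → (FWord k → Set) → ℕ → Set
IsCard {k} P c = Σ (List (FWord k)) λ xs → Unique xs × (length xs ≡ c) × (∀ w → (w ∈ xs) ⇔ P w)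

IsFactorComplexity : ∀ {k} → Word k → (ℕ → ℕ) → Set
IsFactorComplexity u C = ∀ n → IsCard (InLangN u n) (C n)

IsPalComplexity : ∀ {k} → Word k → (ℕ → ℕ) → Set
IsPalComplexity u P = ∀ n → IsCard (λ w → InLangN u n w × IsPalindrome w) (P n)

T : (ℕ → ℕ) → (ℕ → ℕ) → ℕ → ℤ
T C P n = + C (suc n) - + C n +ℤ + 2 - + P (suc n) - + P n

factorsF : ∀ {k} → FWord k → List (FWord k)
factorsF w = concatMap (λ i → map (λ l → take l (drop i w)) (upTo (suc (length w ∸ i)))) (upTo (suc (length w)))

palFactors : ∀ {k} → FWord k → List (FWord k)
palFactors w = filter (λ v → v ≟w reverse v) (deduplicate _≟w_ (factorsF w))

defectF : ∀ {k} → FWord k → ℤ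
defectF w = + (suc (length w)) - + length (palFactors w)

-- d is the supremum of D(prefix) over all prefixes and is attained (= D(u) finite)
IsDefect : ∀ {k} → Word k → ℤ → Set
IsDefect u d = (∀ n → defectF (prefix u n) Data.Integer.≤ d) × (∃[ n ] defectF (prefix u n) ≡ d)

sumBelow : (ℕ → ℤ) → ℕ → ℤ
sumBelow f zero = + 0
sumBelow f (suc N) = sumBelow f N +ℤ f N

{-# OPTIONS --safe #-}
module Submission where

-- Appending a letter to a word creates at most one new palindrome, so along the prefixes of u the
-- defect grows exactly at the letters that create none. Once it has reached D(u), say on the prefix
-- of length q, that prefix has q + 1 - D(u) palindromes and every later letter creates a new one.
--
-- Let L = q + 1, let s be the palindrome created by a later letter and f the suffix of length L at
-- that letter. If |s| ≤ L, then s is a suffix of f and a prefix of the reversal of f, so neither of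
-- these has occurred before; if |s| > L, then the reversal of f is a proper prefix of s, so it has.
-- Hence the palindromes of length at most L missing from the prefix of length q correspond to the
-- leaders of length L, the factors that occur no later than their reversals. Every factor is a
-- leader or the reversal of one, and both only if it is a palindrome, so there are
-- (C(L) + P(L)) / 2 leaders, whence
--   2 Σ_{n ≤ L} P(n) = 2 (L - D(u)) + C(L) + P(L),
-- and this is Σ_{n < L} T(n) = 2 D(u) after telescoping.

open import Defs
open import Algebra.Properties.AbelianGroup using (∙-cancelˡ)
import Data.Fin as Fin
open import Data.Integer using (ℤ; +_; _*_)
import Data.Integer as ℤ
import Data.Integer.Properties as ℤₚ
import Data.Integer.Tactic.RingSolver as ℤ-Solver
open import Data.List
  using (List; []; _∷_; _∷ʳ_; [_]; _++_; length; map; take; drop; filter; reverse; applyUpTo; upTo;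
         initLast; _∷ʳ′_)
open import Data.List.Membership.Propositional using (_∈_; find; lose)
open import Data.List.Membership.Propositional.Properties
  using (∈-++⁺ˡ; ∈-++⁺ʳ; ∈-++⁻; ∈-map⁺; ∈-map⁻; ∈-concatMap⁺; ∈-concatMap⁻; ∈-upTo⁺;
         ∈-filter⁺; ∈-filter⁻; ∈-deduplicate⁺; ∈-deduplicate⁻)
open import Data.List.Membership.Propositional.Properties.WithK using (unique∧set⇒bag)
open import Data.List.Properties
open import Data.List.Relation.Binary.BagAndSetEquality using (∼bag⇒↭)
open import Data.List.Relation.Binary.Infix.Heterogeneous as Infix using (Infix; MkView; _ⁱ++_)
import Data.List.Relation.Binary.Infix.Heterogeneous.Properties as Infixₚ
open import Data.List.Relation.Binary.Permutation.Propositional.Properties using (↭-length)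
open import Data.List.Relation.Binary.Pointwise as Pointwise using (Pointwise-≡⇒≡)
open import Data.List.Relation.Binary.Suffix.Heterogeneous as Suffix
  using (Suffix; here; there; _++ˢ_)
import Data.List.Relation.Binary.Suffix.Heterogeneous.Properties as Suffixₚ
open import Data.List.Relation.Unary.All as All using ([])
open import Data.List.Relation.Unary.AllPairs using ([]; _∷_)
open import Data.List.Relation.Unary.Any using (here; there; any?)
import Data.List.Relation.Unary.Unique.DecPropositional.Properties as DecUnique
open import Data.List.Relation.Unary.Unique.Propositional using (Unique)
import Data.List.Relation.Unary.Unique.Propositional.Properties as Unique
open import Data.Nat
  using (ℕ; zero; suc; _+_; _∸_; _≤_; _<_; _≥_; _⊔_; z≤n; s≤s; z<s; s≤s⁻¹; _≤′_; ≤′-refl; ≤′-step)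
import Data.Nat as ℕ
open import Data.Nat.Properties
import Data.Nat.Tactic.RingSolver as ℕ-Solver
open import Data.Product using (∃; ∃-syntax; ∃₂; _×_; _,_; proj₁; proj₂)
open import Data.Sum as Sum using (_⊎_; inj₁; inj₂)
open import Function using (_∘_; id)
open import Function.Bundles using (mk⇔; Equivalence)
open import Level using (Level)
open import Relation.Binary.PropositionalEquality
  using (_≡_; refl; sym; trans; cong; cong₂; subst; module ≡-Reasoning)
open import Relation.Nullary using (¬_; Dec; yes; no; contradiction)
open import Relation.Nullary.Decidable using (map′; decidable-stable)
open import Relation.Unary using (Decidable; _∩_; _∪_; ∁; _⊢_; _⊆_; _≐_; _⊥_)
open import Relation.Unary.Properties using (∁?)
open Equivalence using (to; from)

private
  variable
    a : Level
    A : Set a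
    k m n : ℕ
    P Q R : FWord k → Set

card-unique : IsCard P m → IsCard P n → m ≡ n
card-unique (xs , xs! , refl , xs⇔) (ys , ys! , refl , ys⇔) =
  ↭-length (∼bag⇒↭ (unique∧set⇒bag xs! ys! λ {w} →
    mk⇔ (from (ys⇔ w) ∘ to (xs⇔ w)) (from (xs⇔ w) ∘ to (ys⇔ w))))

card-cong : P ≐ Q → IsCard P n → IsCard Q n
card-cong (P⊆Q , Q⊆P) (xs , xs! , |xs| , xs⇔) =
  xs , xs! , |xs| , λ w → mk⇔ (P⊆Q ∘ to (xs⇔ w)) (from (xs⇔ w) ∘ Q⊆P)

card-∅ : (∀ {w} → ¬ P w) → IsCard P 0
card-∅ ¬P = [] , [] , refl , λ w → mk⇔ (λ ()) (λ p → contradiction p ¬P)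

card-singleton : (v : FWord k) → IsCard (_≡ v) 1
card-singleton v = [ v ] , [] ∷ [] , refl , λ w → mk⇔ (λ { (here w≡v) → w≡v }) here

card-∪ : P ⊥ Q → IsCard P m → IsCard Q n → IsCard (P ∪ Q) (m + n)
card-∪ P⊥Q (xs , xs! , refl , xs⇔) (ys , ys! , refl , ys⇔) =
  xs ++ ys ,
  Unique.++⁺ xs! ys! (λ {w} (w∈xs , w∈ys) → P⊥Q (to (xs⇔ w) w∈xs , to (ys⇔ w) w∈ys)) ,
  length-++ xs ,
  λ w → mk⇔ (Sum.map (to (xs⇔ w)) (to (ys⇔ w)) ∘ ∈-++⁻ xs)
            Sum.[ ∈-++⁺ˡ ∘ from (xs⇔ w) , ∈-++⁺ʳ xs ∘ from (ys⇔ w) ]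

card-∩ : Decidable Q → IsCard P n → ∃ (IsCard (P ∩ Q))
card-∩ Q? (xs , xs! , _ , xs⇔) =
  length (filter Q? xs) , filter Q? xs , Unique.filter⁺ Q? xs! , refl ,
  λ w → mk⇔ (λ w∈ → let w∈xs , q = ∈-filter⁻ Q? w∈ in to (xs⇔ w) w∈xs , q)
            (λ (p , q) → ∈-filter⁺ Q? (from (xs⇔ w) p) q)

card-split : Decidable Q → IsCard P n →
  ∃₂ λ i j → IsCard (P ∩ Q) i × IsCard (P ∩ ∁ Q) j × i + j ≡ n
card-split {Q = Q} {P = P} Q? |P| =
  let i , |P∩Q|  = card-∩ Q? |P|
      j , |P∩∁Q| = card-∩ (∁? Q?) |P|
  in i , j , |P∩Q| , |P∩∁Q| ,
     card-unique
       (card-cong (Sum.[ proj₁ , proj₁ ] , split)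
         (card-∪ (λ ((_ , q) , (_ , ¬q)) → ¬q q) |P∩Q| |P∩∁Q|))
       |P|
  where
  split : P ⊆ (P ∩ Q) ∪ (P ∩ ∁ Q)
  split {w} p with Q? w
  ... | yes q = inj₁ (p , q)
  ... | no ¬q = inj₂ (p , ¬q)

card-∃? : IsCard P n → Decidable Q → Dec (∃ (P ∩ Q))
card-∃? (xs , _ , _ , xs⇔) Q? = map′
  (λ any → let w , w∈xs , q = find any in w , to (xs⇔ w) w∈xs , q)
  (λ (w , p , q) → lose (from (xs⇔ w) p) q)
  (any? Q? xs)

card-reverse : IsCard P n → IsCard (reverse ⊢ P) n
card-reverse {P = P} (xs , xs! , |xs| , xs⇔) =
  map reverse xs , Unique.map⁺ reverse-injective xs! , trans (length-map reverse xs) |xs| ,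
  λ w → mk⇔ unmap
    (subst (_∈ map reverse xs) (reverse-involutive w) ∘ ∈-map⁺ reverse ∘ from (xs⇔ (reverse w)))
  where
  unmap : ∀ {w} → w ∈ map reverse xs → P (reverse w)
  unmap w∈ with ∈-map⁻ reverse w∈
  ... | v , v∈xs , refl = subst P (sym (reverse-involutive v)) (to (xs⇔ v) v∈xs)

Image : (FWord k → FWord k → Set) → (FWord k → Set) → FWord k → Set
Image _∼_ P w = ∃[ v ] (P v × v ∼ w)

module _ (_∼_ : FWord k → FWord k → Set)
  (total      : ∀ {v} → P v → ∃ (v ∼_))
  (functional : ∀ {v w w′} → P v → v ∼ w → v ∼ w′ → w ≡ w′)
  (injective  : ∀ {v v′ w} → P v → P v′ → v ∼ w → v′ ∼ w → v ≡ v′) where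

  card-Image-∈ : ∀ {xs} → Unique xs → (_∈ xs) ⊆ P → IsCard (Image _∼_ (_∈ xs)) (length xs)
  card-Image-∈ {[]}     _            _    = card-∅ λ ()
  card-Image-∈ {x ∷ xs} (x∉xs ∷ xs!) xs⊆P with total (xs⊆P (here refl))
  ... | y , x∼y = card-cong (glue , unglue)
    (card-∪ disjoint (card-singleton y) (card-Image-∈ xs! (xs⊆P ∘ there)))
    where
    disjoint : (_≡ y) ⊥ Image _∼_ (_∈ xs)
    disjoint (refl , v , v∈xs , v∼y) =
      All.lookup x∉xs v∈xs (injective (xs⊆P (here refl)) (xs⊆P (there v∈xs)) x∼y v∼y)
    glue : (_≡ y) ∪ Image _∼_ (_∈ xs) ⊆ Image _∼_ (_∈ x ∷ xs)
    glue (inj₁ refl)             = x , here refl , x∼y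
    glue (inj₂ (v , v∈xs , v∼w)) = v , there v∈xs , v∼w
    unglue : Image _∼_ (_∈ x ∷ xs) ⊆ (_≡ y) ∪ Image _∼_ (_∈ xs)
    unglue (v , here refl  , v∼w) = inj₁ (functional (xs⊆P (here refl)) v∼w x∼y)
    unglue (v , there v∈xs , v∼w) = inj₂ (v , v∈xs , v∼w)

  card-Image : IsCard P n → IsCard (Image _∼_ P) n
  card-Image (xs , xs! , refl , xs⇔) = card-cong
    ( (λ (v , v∈xs , v∼w) → v , to (xs⇔ v) v∈xs , v∼w)
    , (λ (v , p , v∼w) → v , from (xs⇔ v) p , v∼w))
    (card-Image-∈ xs! (to (xs⇔ _)))

isPalindrome? : Decidable (IsPalindrome {k})
isPalindrome? w = w ≟w reverse w

-- P consists of R and the mirror images of the non-palindromes of R.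
card-reversal-transversal : ∀ {r c p} →
  (∀ {w} → R w → R (reverse w) → IsPalindrome w) → P ≐ R ∪ (reverse ⊢ R) →
  IsCard R r → IsCard P c → IsCard (P ∩ IsPalindrome) p → 2 ℕ.* r ≡ c + p
card-reversal-transversal {R = R} {P = P} {c = c} {p} antisym (P⊆ , ⊆P) |R| |P| |P∩Pal|
  with i , j , |R∩Pal| , |R∩∁Pal| , refl ← card-split isPalindrome? |R| = begin
    2 ℕ.* (i + j) ≡⟨ regroup i j ⟩
    i + j + j + i ≡⟨ cong₂ _+_ |R∪R̄|≡c |R∩Pal|≡p ⟩
    c + p         ∎
  where
  open ≡-Reasoning
  regroup : ∀ i j → 2 ℕ.* (i + j) ≡ i + j + j + i
  regroup = ℕ-Solver.solve-∀
  |R∪R̄|≡c : i + j + j ≡ c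
  |R∪R̄|≡c = card-unique
    (card-cong (Sum.[ ⊆P ∘ inj₁ , ⊆P ∘ inj₂ ∘ proj₁ ] , split)
      (card-∪ disjoint |R| (card-reverse |R∩∁Pal|)))
    |P|
    where
    disjoint : R ⊥ (reverse ⊢ (R ∩ ∁ IsPalindrome))
    disjoint (rw , rw̄ , ¬pal) = ¬pal (cong reverse (antisym rw rw̄))
    split : P ⊆ R ∪ (reverse ⊢ (R ∩ ∁ IsPalindrome))
    split {w} pw with P⊆ pw | isPalindrome? (reverse w)
    ... | inj₁ rw | _       = inj₁ rw
    ... | inj₂ rw̄ | no ¬pal = inj₂ (rw̄ , ¬pal)
    ... | inj₂ rw̄ | yes pal = inj₁ (subst R (trans pal (reverse-involutive w)) rw̄)
  |R∩Pal|≡p : i ≡ p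
  |R∩Pal|≡p = card-unique
    (card-cong ((λ (rw , pal) → ⊆P (inj₁ rw) , pal) , in-R) |R∩Pal|)
    |P∩Pal|
    where
    in-R : P ∩ IsPalindrome ⊆ R ∩ IsPalindrome
    in-R (pw , pal) = Sum.[ id , subst R (sym pal) ] (P⊆ pw) , pal

sumUpTo : (ℕ → ℕ) → ℕ → ℕ
sumUpTo c zero    = c 0
sumUpTo c (suc n) = sumUpTo c n + c (suc n)

card-length≤ : ∀ {c} → (∀ n → IsCard (length ⊢ (_≡ n) ∩ P) (c n)) →
  ∀ n → IsCard (length ⊢ (_≤ n) ∩ P) (sumUpTo c n)
card-length≤ |P≡| zero = card-cong
  ((λ (|w| , p) → ≤-reflexive |w| , p) , (λ (|w| , p) → n≤0⇒n≡0 |w| , p)) (|P≡| 0)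
card-length≤ {P = P} |P≡| (suc n) = card-cong (merge , split)
  (card-∪ disjoint (card-length≤ |P≡| n) (|P≡| (suc n)))
  where
  disjoint : (length ⊢ (_≤ n) ∩ P) ⊥ (length ⊢ (_≡ suc n) ∩ P)
  disjoint ((|w|≤n , _) , (|w|≡1+n , _)) = <⇒≱ (≤-reflexive (sym |w|≡1+n)) |w|≤n
  merge : (length ⊢ (_≤ n) ∩ P) ∪ (length ⊢ (_≡ suc n) ∩ P) ⊆ length ⊢ (_≤ suc n) ∩ P
  merge (inj₁ (|w| , p)) = m≤n⇒m≤1+n |w| , p
  merge (inj₂ (|w| , p)) = ≤-reflexive |w| , p
  split : length ⊢ (_≤ suc n) ∩ P ⊆ (length ⊢ (_≤ n) ∩ P) ∪ (length ⊢ (_≡ suc n) ∩ P)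
  split (|w| , p) with m≤n⇒m<n∨m≡n |w|
  ... | inj₁ |w|<1+n = inj₁ (s≤s⁻¹ |w|<1+n , p)
  ... | inj₂ |w|≡1+n = inj₂ (|w|≡1+n , p)

infix 4 _isFactorOf_ _isSuffixOf_

_isFactorOf_ _isSuffixOf_ : List A → List A → Set _
_isFactorOf_ = Infix _≡_
_isSuffixOf_ = Suffix _≡_

isFactorOf⇒++ : {v w : List A} → v isFactorOf w → ∃₂ λ x y → x ++ v ++ y ≡ w
isFactorOf⇒++ v⊑w with MkView x v≋v′ y ← Infix.toView v⊑w =
  x , y , cong (λ v → x ++ v ++ y) (Pointwise-≡⇒≡ v≋v′)

++⇒isFactorOf : ∀ (x : List A) {v} y {w} → x ++ v ++ y ≡ w → v isFactorOf w
++⇒isFactorOf x y refl = Infix.fromView (MkView x (Pointwise.refl refl) y)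

isFactorOf-trans : {u v w : List A} → u isFactorOf v → v isFactorOf w → u isFactorOf w
isFactorOf-trans = Infixₚ.trans trans

isSuffixOf⇒++ : {v w : List A} → v isSuffixOf w → ∃[ x ] x ++ v ≡ w
isSuffixOf⇒++ v⊑w with x Suffix.++ v≋v′ ← Suffix.toView v⊑w =
  x , cong (x ++_) (Pointwise-≡⇒≡ v≋v′)

++⇒isSuffixOf : ∀ (x : List A) {v w} → x ++ v ≡ w → v isSuffixOf w
++⇒isSuffixOf x refl = x ++ˢ Suffixₚ.fromPointwise (Pointwise.refl refl)

isFactorOf-∷ʳ⁻ : ∀ {v w : List A} {c} →
  v isFactorOf w ∷ʳ c → v isFactorOf w ⊎ v isSuffixOf w ∷ʳ c
isFactorOf-∷ʳ⁻ {v = v} {w} v⊑wc with isFactorOf⇒++ v⊑wc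
... | x , y , eq with initLast y
... | []       = inj₂ (++⇒isSuffixOf x (trans (cong (x ++_) (sym (++-identityʳ v))) eq))
... | y′ ∷ʳ′ d = inj₁ (++⇒isFactorOf x y′ (∷ʳ-injectiveˡ (x ++ v ++ y′) w (begin
  (x ++ v ++ y′) ∷ʳ d ≡⟨ ++-assoc x (v ++ y′) [ d ] ⟩
  x ++ (v ++ y′) ∷ʳ d ≡⟨ cong (x ++_) (++-assoc v y′ [ d ]) ⟩
  x ++ v ++ y′ ∷ʳ d   ≡⟨ eq ⟩
  w ∷ʳ _              ∎)))
  where open ≡-Reasoning

isSuffixOf-∷ʳ⁻ : ∀ {v w : List A} {c d} → v ∷ʳ c isSuffixOf w ∷ʳ d → v isSuffixOf w
isSuffixOf-∷ʳ⁻ {v = v} {w} {c} vc⊑wd with x , eq ← isSuffixOf⇒++ vc⊑wd =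
  ++⇒isSuffixOf x (∷ʳ-injectiveˡ (x ++ v) w (trans (++-assoc x v [ c ]) eq))

isSuffixOf-comparable : {v v′ w : List A} →
  v isSuffixOf w → v′ isSuffixOf w → length v ≤ length v′ → v isSuffixOf v′
isSuffixOf-comparable (here v≋w) (here v′≋w) _
  with refl ← Pointwise-≡⇒≡ v≋w | refl ← Pointwise-≡⇒≡ v′≋w = here v≋w
isSuffixOf-comparable (there v⊑w) (here v′≋cw) _
  with refl ← Pointwise-≡⇒≡ v′≋cw = there v⊑w
isSuffixOf-comparable (here v≋cw) (there v′⊑w) |v|≤|v′|
  with refl ← Pointwise-≡⇒≡ v≋cw =
    contradiction |v|≤|v′| (<⇒≱ (s≤s (Suffixₚ.length-mono v′⊑w)))
isSuffixOf-comparable (there v⊑w) (there v′⊑w) |v|≤|v′| = isSuffixOf-comparable v⊑w v′⊑w |v|≤|v′|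

isSuffixOf-unique : {v v′ w : List A} →
  v isSuffixOf w → v′ isSuffixOf w → length v ≡ length v′ → v ≡ v′
isSuffixOf-unique v⊑w v′⊑w |v|≡|v′| = Pointwise-≡⇒≡
  (Suffixₚ.toPointwise |v|≡|v′| (isSuffixOf-comparable v⊑w v′⊑w (≤-reflexive |v|≡|v′|)))

∃-isSuffixOf : {w : List A} → n ≤ length w → ∃[ v ] (v isSuffixOf w × length v ≡ n)
∃-isSuffixOf {n = n} {w = w} n≤|w| = drop (length w ∸ n) w ,
  ++⇒isSuffixOf (take (length w ∸ n) w) (take++drop≡id (length w ∸ n) w) ,
  trans (length-drop (length w ∸ n) w) (m∸[m∸n]≡n n≤|w|)

isFactorOf-reverse : {v w : List A} → v isFactorOf w → reverse v isFactorOf reverse w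
isFactorOf-reverse {v = v} v⊑w with x , y , refl ← isFactorOf⇒++ v⊑w =
  ++⇒isFactorOf (reverse y) (reverse x) (begin
    reverse y ++ reverse v ++ reverse x   ≡⟨ ++-assoc (reverse y) (reverse v) (reverse x) ⟨
    (reverse y ++ reverse v) ++ reverse x ≡⟨ cong (_++ reverse x) (reverse-++ v y) ⟨
    reverse (v ++ y) ++ reverse x         ≡⟨ reverse-++ x (v ++ y) ⟨
    reverse (x ++ v ++ y)                 ∎)
  where open ≡-Reasoning

take-drop-isFactorOf : ∀ l i (w : List A) → take l (drop i w) isFactorOf w
take-drop-isFactorOf l i w = ++⇒isFactorOf (take i w) (drop l (drop i w))
  (trans (cong (take i w ++_) (take++drop≡id l (drop i w))) (take++drop≡id i w))

take-drop-++ : ∀ (x v y : List A) → take (length v) (drop (length x) (x ++ v ++ y)) ≡ v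
take-drop-++ []      []      y = refl
take-drop-++ []      (c ∷ v) y = cong (c ∷_) (take-drop-++ [] v y)
take-drop-++ (_ ∷ x) v       y = take-drop-++ x v y

applyUpTo-+ : ∀ (f : ℕ → A) m n →
  applyUpTo f (m + n) ≡ applyUpTo f m ++ applyUpTo (λ j → f (m + j)) n
applyUpTo-+ f zero    n = refl
applyUpTo-+ f (suc m) n = cong (f 0 ∷_) (applyUpTo-+ (f ∘ suc) m n)

applyUpTo-++⁻ : ∀ {f : ℕ → A} x v {y} → x ++ v ++ y ≡ applyUpTo f n →
  applyUpTo (λ j → f (length x + j)) (length v) ≡ v
applyUpTo-++⁻             []      []      _  = refl
applyUpTo-++⁻ {n = suc n} []      (_ ∷ v) eq =
  cong₂ _∷_ (sym (∷-injectiveˡ eq)) (applyUpTo-++⁻ [] v (∷-injectiveʳ eq))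
applyUpTo-++⁻ {n = suc n} (_ ∷ x) v       eq = applyUpTo-++⁻ x v (∷-injectiveʳ eq)

factorsFrom : FWord k → ℕ → List (FWord k)
factorsFrom w i = map (λ l → take l (drop i w)) (upTo (suc (length w ∸ i)))

∈-factorsF⇒isFactorOf : ∀ (w : FWord k) {v} → v ∈ factorsF w → v isFactorOf w
∈-factorsF⇒isFactorOf w v∈
  with i , _ , v∈ᵢ ← find (∈-concatMap⁻ (factorsFrom w) {xs = upTo (suc (length w))} v∈)
  with l , _ , refl ← ∈-map⁻ (λ l → take l (drop i w)) {xs = upTo (suc (length w ∸ i))} v∈ᵢ =
    take-drop-isFactorOf l i w

isFactorOf⇒∈-factorsF : {v w : FWord k} → v isFactorOf w → v ∈ factorsF w
isFactorOf⇒∈-factorsF {v = v} v⊑w with x , y , refl ← isFactorOf⇒++ v⊑w =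
  ∈-concatMap⁺ (factorsFrom (x ++ v ++ y)) (lose (∈-upTo⁺ (s≤s (length-++-≤ˡ x))) v∈factorsFrom)
  where
  open ≤-Reasoning
  |v|≤ : length v ≤ length (x ++ v ++ y) ∸ length x
  |v|≤ = begin
    length v                              ≤⟨ length-++-≤ˡ v ⟩
    length (v ++ y)                       ≡⟨ m+n∸m≡n (length x) (length (v ++ y)) ⟨
    length x + length (v ++ y) ∸ length x ≡⟨ cong (_∸ length x) (length-++ x) ⟨
    length (x ++ v ++ y) ∸ length x       ∎
  v∈factorsFrom : v ∈ factorsFrom (x ++ v ++ y) (length x)
  v∈factorsFrom = subst (_∈ factorsFrom (x ++ v ++ y) (length x)) (take-drop-++ x v y)
    (∈-map⁺ (λ l → take l (drop (length x) (x ++ v ++ y))) (∈-upTo⁺ (s≤s |v|≤)))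

card-palFactors : (w : FWord k) →
  IsCard ((_isFactorOf w) ∩ IsPalindrome) (length (palFactors w))
card-palFactors w =
  palFactors w ,
  Unique.filter⁺ isPalindrome? (DecUnique.deduplicate-! _≟w_ (factorsF w)) ,
  refl ,
  λ v → mk⇔
    (λ v∈ → let v∈′ , pal = ∈-filter⁻ isPalindrome? v∈
            in ∈-factorsF⇒isFactorOf w (∈-deduplicate⁻ _≟w_ _ v∈′) , pal)
    (λ (v⊑w , pal) →
      ∈-filter⁺ isPalindrome? (∈-deduplicate⁺ _≟w_ (isFactorOf⇒∈-factorsF v⊑w)) pal)

palindrome-isFactorOf-reverse : {s w : FWord k} →
  IsPalindrome s → s isFactorOf w → s isFactorOf reverse w
palindrome-isFactorOf-reverse {w = w} pal s⊑w =
  subst (_isFactorOf reverse w) (sym pal) (isFactorOf-reverse s⊑w)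

palindromic-suffix-tail-recurs : ∀ {s w : FWord k} {c d} →
  IsPalindrome (c ∷ s) → c ∷ s isSuffixOf w ∷ʳ d → reverse s isFactorOf w
palindromic-suffix-tail-recurs {s = s} {w} {c} {d} pal s⊑wd = Infixₚ.fromSuffix
  (isSuffixOf-∷ʳ⁻ {d = d} (subst (_isSuffixOf w ∷ʳ d) (trans pal (unfold-reverse c s)) s⊑wd))

shorter-suffix-recurs-reversed : ∀ {s v w : FWord k} {c} → IsPalindrome s →
  s isSuffixOf w ∷ʳ c → v isSuffixOf w ∷ʳ c → length v < length s → reverse v isFactorOf w
shorter-suffix-recurs-reversed pal s⊑wc v⊑wc |v|<|s|
  with isSuffixOf-comparable v⊑wc s⊑wc (<⇒≤ |v|<|s|)
... | here v≋s   = contradiction (Pointwise.Pointwise-length v≋s) (<⇒≢ |v|<|s|)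
... | there v⊑s′ = isFactorOf-trans
  (isFactorOf-reverse (Infixₚ.fromSuffix v⊑s′)) (palindromic-suffix-tail-recurs pal s⊑wc)

module _ (u : Word k) where

  OccursBy : ℕ → FWord k → Set
  OccursBy m w = w isFactorOf prefix u m

  EntersAt : ℕ → FWord k → Set
  EntersAt m w = w isSuffixOf prefix u m ∷ʳ u m × ¬ OccursBy m w

  occursBy? : ∀ m → Decidable (OccursBy m)
  occursBy? m w = Infixₚ.infix? Fin._≟_ w (prefix u m)

  length-prefix-∷ʳ : ∀ m → length (prefix u m ∷ʳ u m) ≡ suc m
  length-prefix-∷ʳ m = trans (cong length (applyUpTo-∷ʳ u m)) (length-applyUpTo u (suc m))

  occursBy-mono : m ≤ n → OccursBy m ⊆ OccursBy n
  occursBy-mono {m} m≤n {w} w⊑ with o , refl ← m≤n⇒∃[o]m+o≡n m≤n =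
    subst (w isFactorOf_) (sym (applyUpTo-+ u m o)) (w⊑ ⁱ++ applyUpTo (λ j → u (m + j)) o)

  occursBy-suc⁻ : ∀ {w} → OccursBy (suc m) w → OccursBy m w ⊎ w isSuffixOf prefix u m ∷ʳ u m
  occursBy-suc⁻ {m} {w} w⊑ =
    isFactorOf-∷ʳ⁻ (subst (w isFactorOf_) (sym (applyUpTo-∷ʳ u m)) w⊑)

  occursBy⇒length≤ : ∀ {w} → OccursBy m w → length w ≤ m
  occursBy⇒length≤ {m} {w} w⊑ = subst (length w ≤_) (length-applyUpTo u m) (Infixₚ.length-mono w⊑)

  inLang⇒occursBy : ∀ {w} → InLang u w → ∃[ m ] OccursBy m w
  inLang⇒occursBy {w} (i , eq) = i + length w , ++⇒isFactorOf (prefix u i) [] (begin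
    prefix u i ++ w ++ []                 ≡⟨ cong (prefix u i ++_) (++-identityʳ w) ⟩
    prefix u i ++ w                       ≡⟨ cong (prefix u i ++_) eq ⟨
    prefix u i ++ factorAt u i (length w) ≡⟨ applyUpTo-+ u i (length w) ⟨
    prefix u (i + length w)               ∎)
    where open ≡-Reasoning

  occursBy⇒inLang : OccursBy m ⊆ InLang u
  occursBy⇒inLang {x = w} w⊑ with x , _ , eq ← isFactorOf⇒++ w⊑ = length x , applyUpTo-++⁻ x w eq

  entersAt⇒occursBy : EntersAt m ⊆ OccursBy (suc m)
  entersAt⇒occursBy {m} {w} (w⊑ , _) =
    subst (w isFactorOf_) (applyUpTo-∷ʳ u m) (Infixₚ.fromSuffix w⊑)

  entersAt-≥ : ∀ {w} → EntersAt n w → ¬ OccursBy m w → m ≤ n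
  entersAt-≥ w↓n w⋢m = ≮⇒≥ λ n<m → w⋢m (occursBy-mono n<m (entersAt⇒occursBy w↓n))

  entersAt-unique : ∀ {w} → EntersAt m w → EntersAt n w → m ≡ n
  entersAt-unique w↓m w↓n = ≤-antisym (entersAt-≥ w↓n (proj₂ w↓m)) (entersAt-≥ w↓m (proj₂ w↓n))

  occursBy⇒entersAt : ∀ {w} → ¬ OccursBy m w → OccursBy n w → ∃[ j ] (j < n × EntersAt j w)
  occursBy⇒entersAt {n = zero}  w⋢m w⊑n = contradiction (occursBy-mono z≤n w⊑n) w⋢m
  occursBy⇒entersAt {n = suc n} {w} w⋢m w⊑1+n with occursBy? n w | occursBy-suc⁻ w⊑1+n
  ... | no  w⋢n | inj₁ w⊑n = contradiction w⊑n w⋢n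
  ... | no  w⋢n | inj₂ suf = n , ≤-refl , suf , w⋢n
  ... | yes w⊑n | _        =
    let j , j<n , w↓j = occursBy⇒entersAt w⋢m w⊑n in j , m<n⇒m<1+n j<n , w↓j

  PalindromeBy NewPalindrome : ℕ → FWord k → Set
  PalindromeBy m  = OccursBy m ∩ IsPalindrome
  NewPalindrome m = EntersAt m ∩ IsPalindrome

  newPalindrome-length≤ : ∀ {s t} → NewPalindrome m s → NewPalindrome m t → length t ≤ length s
  newPalindrome-length≤ {m} {s} ((s⊑ , s⋢m) , s-pal) ((t⊑ , _) , t-pal) = ≮⇒≥ λ |s|<|t| →
    s⋢m (subst (OccursBy m) (sym s-pal) (shorter-suffix-recurs-reversed t-pal t⊑ s⊑ |s|<|t|))

  newPalindrome-unique : ∀ {s t} → NewPalindrome m s → NewPalindrome m t → s ≡ t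
  newPalindrome-unique s-new@((s⊑ , _) , _) t-new@((t⊑ , _) , _) = isSuffixOf-unique s⊑ t⊑
    (≤-antisym (newPalindrome-length≤ t-new s-new) (newPalindrome-length≤ s-new t-new))

  newPalindrome⇒suffix-new : ∀ {s w} → NewPalindrome m s →
    w isSuffixOf prefix u m ∷ʳ u m → length s ≤ length w →
    ¬ OccursBy m w × ¬ OccursBy m (reverse w)
  newPalindrome⇒suffix-new {s = s} {w} ((s⊑ , s⋢m) , pal) w⊑ |s|≤|w| =
    s⋢m ∘ isFactorOf-trans s⊑w , s⋢m ∘ isFactorOf-trans (palindrome-isFactorOf-reverse pal s⊑w)
    where
    s⊑w : s isFactorOf w
    s⊑w = Infixₚ.fromSuffix (isSuffixOf-comparable s⊑ w⊑ |s|≤|w|)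

  #palindromes : ℕ → ℕ
  #palindromes m = length (palFactors (prefix u m))

  card-palindromeBy : ∀ m → IsCard (PalindromeBy m) (#palindromes m)
  card-palindromeBy m = card-palFactors (prefix u m)

  palindromeBy-suc⁺ : NewPalindrome m ∪ PalindromeBy m ⊆ PalindromeBy (suc m)
  palindromeBy-suc⁺ (inj₁ (w↓m , pal)) = entersAt⇒occursBy w↓m , pal
  palindromeBy-suc⁺ (inj₂ (w⊑m , pal)) = occursBy-mono (n≤1+n _) w⊑m , pal

  palindromeBy-suc⁻ : PalindromeBy (suc m) ⊆ NewPalindrome m ∪ PalindromeBy m
  palindromeBy-suc⁻ {m} {w} (w⊑1+m , pal) with occursBy? m w | occursBy-suc⁻ w⊑1+m
  ... | yes w⊑m | _        = inj₂ (w⊑m , pal)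
  ... | no  w⋢m | inj₁ w⊑m = contradiction w⊑m w⋢m
  ... | no  w⋢m | inj₂ suf = inj₁ ((suf , w⋢m) , pal)

  ∃newPalindrome? : ∀ m → Dec (∃ (NewPalindrome m))
  ∃newPalindrome? m = map′ toNew fromNew (card-∃? (card-palindromeBy (suc m)) (∁? (occursBy? m)))
    where
    toNew : ∃ (PalindromeBy (suc m) ∩ ∁ (OccursBy m)) → ∃ (NewPalindrome m)
    toNew (s , s-pal , s⋢m) =
      s , Sum.[ id , (λ (s⊑m , _) → contradiction s⊑m s⋢m) ] (palindromeBy-suc⁻ s-pal)
    fromNew : ∃ (NewPalindrome m) → ∃ (PalindromeBy (suc m) ∩ ∁ (OccursBy m))
    fromNew (s , s-new) = s , palindromeBy-suc⁺ (inj₁ s-new) , proj₂ (proj₁ s-new)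

  newPalindrome⇒#palindromes-suc : ∃ (NewPalindrome m) → #palindromes (suc m) ≡ suc (#palindromes m)
  newPalindrome⇒#palindromes-suc {m} (s , s-new) =
    card-unique (card-palindromeBy (suc m)) (card-cong
      ( palindromeBy-suc⁺ ∘ Sum.map₁ (λ { refl → s-new })
      , Sum.map₁ (λ w-new → newPalindrome-unique w-new s-new) ∘ palindromeBy-suc⁻)
      (card-∪ (λ { (refl , s⊑m , _) → proj₂ (proj₁ s-new) s⊑m })
        (card-singleton s) (card-palindromeBy m)))

  ¬newPalindrome⇒#palindromes-suc : ¬ ∃ (NewPalindrome m) → #palindromes (suc m) ≡ #palindromes m
  ¬newPalindrome⇒#palindromes-suc {m} none =
    card-unique (card-palindromeBy (suc m)) (card-cong
      ( palindromeBy-suc⁺ ∘ inj₂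
      , Sum.[ (λ w-new → contradiction (_ , w-new) none) , id ] ∘ palindromeBy-suc⁻)
      (card-palindromeBy m))

  defect : ℕ → ℤ
  defect m = defectF (prefix u m)

  defect≡1+m-#palindromes : ∀ m → defect m ≡ + suc m ℤ.- + #palindromes m
  defect≡1+m-#palindromes m = cong (λ n → + suc n ℤ.- + #palindromes m) (length-applyUpTo u m)

  newPalindrome⇒defect-suc : ∀ m → ∃ (NewPalindrome m) → defect (suc m) ≡ defect m
  newPalindrome⇒defect-suc m new = begin
    defect (suc m)
      ≡⟨ defect≡1+m-#palindromes (suc m) ⟩
    + suc (suc m) ℤ.- + #palindromes (suc m)
      ≡⟨ cong (λ n → + suc (suc m) ℤ.- + n) (newPalindrome⇒#palindromes-suc new) ⟩
    + suc (suc m) ℤ.- + suc (#palindromes m)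
      ≡⟨ cancel (+ suc m) (+ #palindromes m) ⟩
    + suc m ℤ.- + #palindromes m
      ≡⟨ defect≡1+m-#palindromes m ⟨
    defect m ∎
    where
    open ≡-Reasoning
    cancel : ∀ i j → (+ 1 ℤ.+ i) ℤ.- (+ 1 ℤ.+ j) ≡ i ℤ.- j
    cancel = ℤ-Solver.solve-∀

  ¬newPalindrome⇒defect-suc : ∀ m → ¬ ∃ (NewPalindrome m) → defect (suc m) ≡ ℤ.suc (defect m)
  ¬newPalindrome⇒defect-suc m none = begin
    defect (suc m)
      ≡⟨ defect≡1+m-#palindromes (suc m) ⟩
    + suc (suc m) ℤ.- + #palindromes (suc m)
      ≡⟨ cong (λ n → + suc (suc m) ℤ.- + n) (¬newPalindrome⇒#palindromes-suc none) ⟩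
    + suc (suc m) ℤ.- + #palindromes m
      ≡⟨ ℤₚ.+-assoc (+ 1) (+ suc m) (ℤ.- + #palindromes m) ⟩
    ℤ.suc (+ suc m ℤ.- + #palindromes m)
      ≡⟨ cong ℤ.suc (defect≡1+m-#palindromes m) ⟨
    ℤ.suc (defect m) ∎
    where open ≡-Reasoning

  defect-suc≤⇒newPalindrome : ∀ m → defect (suc m) ℤ.≤ defect m → ∃ (NewPalindrome m)
  defect-suc≤⇒newPalindrome m ≤defect = decidable-stable (∃newPalindrome? m) λ none →
    ℤₚ.<-irrefl refl (ℤₚ.suc[i]≤j⇒i<j
      (subst (ℤ._≤ defect m) (¬newPalindrome⇒defect-suc m none) ≤defect))

  Saturated : ℕ → Set
  Saturated q = ∀ m → q ≤ m → ∃ (NewPalindrome m)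

  module _ {d : ℤ} (defect≤d : ∀ m → defect m ℤ.≤ d) where

    maximal-defect-stable : defect m ≡ d → m ≤′ n → defect n ≡ d
    maximal-defect-stable eq ≤′-refl = eq
    maximal-defect-stable {n = suc n} eq (≤′-step m≤n)
      with refl ← maximal-defect-stable eq m≤n =
        newPalindrome⇒defect-suc n (defect-suc≤⇒newPalindrome n (defect≤d (suc n)))

    maximal-defect⇒saturated : ∀ q → defect q ≡ d → Saturated q
    maximal-defect⇒saturated q eq m q≤m = defect-suc≤⇒newPalindrome m
      (subst (defect (suc m) ℤ.≤_) (sym (maximal-defect-stable eq (≤⇒≤′ q≤m))) (defect≤d (suc m)))

  IsLeader : FWord k → Set
  IsLeader w = ∃[ m ] (EntersAt m w × ¬ OccursBy m (reverse w))

  leader⇒inLang : IsLeader ⊆ InLang u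
  leader⇒inLang (_ , w↓m , _) = occursBy⇒inLang (entersAt⇒occursBy w↓m)

  leader-reverse⇒palindrome : ∀ {w} → IsLeader w → IsLeader (reverse w) → IsPalindrome w
  leader-reverse⇒palindrome {w} (m , w↓m , w̄⋢m) (n , w̄↓n , w⋢n)
    with refl ← ≤-antisym
      (entersAt-≥ w̄↓n w̄⋢m)
      (entersAt-≥ w↓m (w⋢n ∘ subst (OccursBy n) (sym (reverse-involutive w)))) =
      isSuffixOf-unique (proj₁ w↓m) (proj₁ w̄↓n) (sym (length-reverse w))

  0<length⇒¬occursBy0 : ∀ {w} → 0 < length w → ¬ OccursBy 0 w
  0<length⇒¬occursBy0 0<|w| = <⇒≱ 0<|w| ∘ occursBy⇒length≤

  inLang⇒leader : ∀ {w} → 0 < length w → InLang u w → IsLeader w ⊎ IsLeader (reverse w)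
  inLang⇒leader {w} 0<|w| w∈u
    with _ , w⊑ ← inLang⇒occursBy w∈u
    with m , _ , w↓m ← occursBy⇒entersAt (0<length⇒¬occursBy0 0<|w|) w⊑
    with occursBy? m (reverse w)
  ... | no  w̄⋢m = inj₁ (m , w↓m , w̄⋢m)
  ... | yes w̄⊑m
    with j , j<m , w̄↓j ← occursBy⇒entersAt
      (0<length⇒¬occursBy0 (subst (0 <_) (sym (length-reverse w)) 0<|w|)) w̄⊑m =
      inj₂ (j , w̄↓j ,
        proj₂ w↓m ∘ occursBy-mono (<⇒≤ j<m) ∘ subst (OccursBy j) (reverse-involutive w))

  LeaderOfLength : ℕ → FWord k → Set
  LeaderOfLength l = length ⊢ (_≡ l) ∩ IsLeader

  inLangN≐leaders : ∀ {l} → ClosedUnderReversal u → 0 < l →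
    InLangN u l ≐ LeaderOfLength l ∪ (reverse ⊢ LeaderOfLength l)
  inLangN≐leaders {l} closed 0<l =
    led , Sum.[ (λ (|w| , w-lead) → |w| , leader⇒inLang w-lead) , reversed ]
    where
    led : InLangN u l ⊆ LeaderOfLength l ∪ (reverse ⊢ LeaderOfLength l)
    led {w} (refl , w∈u) = Sum.map (refl ,_) (length-reverse w ,_) (inLang⇒leader 0<l w∈u)
    reversed : reverse ⊢ LeaderOfLength l ⊆ InLangN u l
    reversed {w} (|w̄| , w̄-lead) = trans (sym (length-reverse w)) |w̄| ,
      subst (InLang u) (reverse-involutive w) (closed (reverse w) (leader⇒inLang w̄-lead))

  2*#leaders≡C+P : ∀ {C P l r} → ClosedUnderReversal u →
    IsFactorComplexity u C → IsPalComplexity u P → 0 < l →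
    IsCard (LeaderOfLength l) r → 2 ℕ.* r ≡ C l + P l
  2*#leaders≡C+P {l = l} closed isC isP 0<l |leaders| = card-reversal-transversal
    (λ (_ , w-lead) (_ , w̄-lead) → leader-reverse⇒palindrome w-lead w̄-lead)
    (inLangN≐leaders closed 0<l) |leaders| (isC l) (isP l)

  LatePalindrome : ℕ → FWord k → Set
  LatePalindrome q = (length ⊢ (_≤ suc q) ∩ (InLang u ∩ IsPalindrome)) ∩ ∁ (OccursBy q)

  EntersWith : ℕ → FWord k → FWord k → Set
  EntersWith l s w = length w ≡ l × ∃[ m ] (EntersAt m s × EntersAt m w)

  latePalindrome⇒entersWith : ∀ {q s} → LatePalindrome q s → ∃ (EntersWith (suc q) s)
  latePalindrome⇒entersWith ((|s|≤1+q , s∈u , pal) , s⋢q)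
    with _ , s⊑ ← inLang⇒occursBy s∈u
    with m , _ , s↓m ← occursBy⇒entersAt s⋢q s⊑
    with w , w⊑ , |w| ← ∃-isSuffixOf
      (≤-trans (s≤s (entersAt-≥ s↓m s⋢q)) (≤-reflexive (sym (length-prefix-∷ʳ m)))) =
      w , |w| , m , s↓m , w⊑ ,
      proj₁ (newPalindrome⇒suffix-new (s↓m , pal) w⊑ (≤-trans |s|≤1+q (≤-reflexive (sym |w|))))

  entersWith-functional : ∀ {l s w w′} → EntersWith l s w → EntersWith l s w′ → w ≡ w′
  entersWith-functional (|w| , _ , s↓m , w↓m) (|w′| , _ , s↓m′ , w′↓m′)
    with refl ← entersAt-unique s↓m s↓m′ =
      isSuffixOf-unique (proj₁ w↓m) (proj₁ w′↓m′) (trans |w| (sym |w′|))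

  entersWith-injective : ∀ {l s s′ w} → IsPalindrome s → IsPalindrome s′ →
    EntersWith l s w → EntersWith l s′ w → s ≡ s′
  entersWith-injective pal pal′ (_ , _ , s↓m , w↓m) (_ , _ , s′↓m′ , w↓m′)
    with refl ← entersAt-unique w↓m w↓m′ =
      newPalindrome-unique (s↓m , pal) (s′↓m′ , pal′)

  image-latePalindrome≐leaders : ∀ {q} → Saturated q →
    Image (EntersWith (suc q)) (LatePalindrome q) ≐ LeaderOfLength (suc q)
  image-latePalindrome≐leaders {q} saturated = leads , created
    where
    leads : Image (EntersWith (suc q)) (LatePalindrome q) ⊆ LeaderOfLength (suc q)
    leads (s , ((|s|≤1+q , _ , pal) , _) , |w| , m , s↓m , w↓m) = |w| , m , w↓m ,
      proj₂ (newPalindrome⇒suffix-new (s↓m , pal) (proj₁ w↓m)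
        (≤-trans |s|≤1+q (≤-reflexive (sym |w|))))
    created : LeaderOfLength (suc q) ⊆ Image (EntersWith (suc q)) (LatePalindrome q)
    created (|w| , m , w↓m , w̄⋢m)
      with q≤m ← s≤s⁻¹ (subst (_≤ suc m) |w| (occursBy⇒length≤ (entersAt⇒occursBy w↓m)))
      with s , s↓m , pal ← saturated m q≤m = s , late , |w| , m , s↓m , w↓m
      where
      |s|≤1+q : length s ≤ suc q
      |s|≤1+q = ≮⇒≥ λ 1+q<|s| → w̄⋢m (shorter-suffix-recurs-reversed pal (proj₁ s↓m) (proj₁ w↓m)
        (subst (_< length s) (sym |w|) 1+q<|s|))
      late : LatePalindrome q s
      late = (|s|≤1+q , occursBy⇒inLang (entersAt⇒occursBy s↓m) , pal) ,
             proj₂ s↓m ∘ occursBy-mono q≤m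

  card-leaders : ∀ {q} → Saturated q →
    IsCard (LatePalindrome q) n → IsCard (LeaderOfLength (suc q)) n
  card-leaders {q = q} saturated |late| = card-cong (image-latePalindrome≐leaders saturated)
    (card-Image (EntersWith (suc q)) latePalindrome⇒entersWith (λ _ → entersWith-functional)
      (λ ((_ , _ , pal) , _) ((_ , _ , pal′) , _) → entersWith-injective pal pal′) |late|)

  card-palindromes≤ : ∀ {P} → IsPalComplexity u P →
    ∀ n → IsCard (length ⊢ (_≤ n) ∩ (InLang u ∩ IsPalindrome)) (sumUpTo P n)
  card-palindromes≤ isP = card-length≤ λ n → card-cong
    ( (λ ((|w| , w∈u) , pal) → |w| , w∈u , pal)
    , (λ (|w| , w∈u , pal) → (|w| , w∈u) , pal))
    (isP n)

  card-latePalindrome : ∀ {P q} → IsPalComplexity u P →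
    ∃[ r ] (IsCard (LatePalindrome q) r × #palindromes q + r ≡ sumUpTo P (suc q))
  card-latePalindrome {q = q} isP =
    let i , r , |early| , |late| , i+r≡ = card-split (occursBy? q) (card-palindromes≤ isP (suc q))
        #palindromes≡i = card-unique (card-palindromeBy q) (card-cong early |early|)
    in r , |late| , trans (cong (_+ r) #palindromes≡i) i+r≡
    where
    early : (length ⊢ (_≤ suc q) ∩ (InLang u ∩ IsPalindrome)) ∩ OccursBy q ≐ PalindromeBy q
    early = (λ ((_ , _ , pal) , w⊑q) → w⊑q , pal) ,
            (λ (w⊑q , pal) →
              (m≤n⇒m≤1+n (occursBy⇒length≤ w⊑q) , occursBy⇒inLang w⊑q , pal) , w⊑q)

  2*sumUpTo-P≡2*#palindromes+C+P : ∀ {C P q} → ClosedUnderReversal u →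
    IsFactorComplexity u C → IsPalComplexity u P → Saturated q →
    2 ℕ.* sumUpTo P (suc q) ≡ 2 ℕ.* #palindromes q + (C (suc q) + P (suc q))
  2*sumUpTo-P≡2*#palindromes+C+P {C} {P} {q} closed isC isP saturated
    with r , |late| , #palindromes+r≡ ← card-latePalindrome isP = begin
      2 ℕ.* sumUpTo P (suc q)                        ≡⟨ cong (2 ℕ.*_) #palindromes+r≡ ⟨
      2 ℕ.* (#palindromes q + r)                     ≡⟨ *-distribˡ-+ 2 (#palindromes q) r ⟩
      2 ℕ.* #palindromes q + 2 ℕ.* r                 ≡⟨ cong (λ n → 2 ℕ.* #palindromes q + n) 2*r≡ ⟩
      2 ℕ.* #palindromes q + (C (suc q) + P (suc q)) ∎
    where
    open ≡-Reasoning
    2*r≡ : 2 ℕ.* r ≡ C (suc q) + P (suc q)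
    2*r≡ = 2*#leaders≡C+P closed isC isP z<s (card-leaders saturated |late|)

  C0≡P0 : ∀ {C P} → IsFactorComplexity u C → IsPalComplexity u P → C 0 ≡ P 0
  C0≡P0 isC isP = card-unique (isC 0)
    (card-cong (proj₁ , λ { {[]} (|w| , w∈u) → (|w| , w∈u) , refl }) (isP 0))

2*sumUpTo-P+sumBelow-T : ∀ C P → C 0 ≡ P 0 → ∀ n →
  + 2 * + sumUpTo P n ℤ.+ sumBelow (T C P) n ≡ + C n ℤ.+ + P n ℤ.+ + 2 * + n
2*sumUpTo-P+sumBelow-T C P C0≡P0 zero rewrite C0≡P0 = double (+ P 0)
  where
  double : ∀ p → + 2 * p ℤ.+ + 0 ≡ p ℤ.+ p ℤ.+ + 0
  double = ℤ-Solver.solve-∀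
2*sumUpTo-P+sumBelow-T C P C0≡P0 (suc n) = begin
  + 2 * (s ℤ.+ p′) ℤ.+ (t ℤ.+ T C P n)
    ≡⟨ split s p′ t c c′ p ⟩
  (+ 2 * s ℤ.+ t) ℤ.+ (c′ ℤ.- c ℤ.+ + 2 ℤ.+ p′ ℤ.- p)
    ≡⟨ cong (ℤ._+ (c′ ℤ.- c ℤ.+ + 2 ℤ.+ p′ ℤ.- p)) (2*sumUpTo-P+sumBelow-T C P C0≡P0 n) ⟩
  (c ℤ.+ p ℤ.+ + 2 * + n) ℤ.+ (c′ ℤ.- c ℤ.+ + 2 ℤ.+ p′ ℤ.- p)
    ≡⟨ telescope c c′ p p′ (+ n) ⟩
  c′ ℤ.+ p′ ℤ.+ + 2 * + suc n ∎
  where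
  open ≡-Reasoning
  s t c c′ p p′ : ℤ
  s  = + sumUpTo P n
  t  = sumBelow (T C P) n
  c  = + C n
  c′ = + C (suc n)
  p  = + P n
  p′ = + P (suc n)
  split : ∀ s p′ t c c′ p → + 2 * (s ℤ.+ p′) ℤ.+ (t ℤ.+ (c′ ℤ.- c ℤ.+ + 2 ℤ.- p′ ℤ.- p))
    ≡ (+ 2 * s ℤ.+ t) ℤ.+ (c′ ℤ.- c ℤ.+ + 2 ℤ.+ p′ ℤ.- p)
  split = ℤ-Solver.solve-∀
  telescope : ∀ c c′ p p′ n → (c ℤ.+ p ℤ.+ + 2 * n) ℤ.+ (c′ ℤ.- c ℤ.+ + 2 ℤ.+ p′ ℤ.- p)
    ≡ c′ ℤ.+ p′ ℤ.+ + 2 * (+ 1 ℤ.+ n)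
  telescope = ℤ-Solver.solve-∀

sumBelow-stable : ∀ (f : ℕ → ℤ) {N} → (∀ n → n ≥ N → f n ≡ + 0) →
  ∀ {M} → N ≤′ M → sumBelow f M ≡ sumBelow f N
sumBelow-stable f vanish ≤′-refl = refl
sumBelow-stable f {N} vanish {suc M} (≤′-step N≤M) = begin
  sumBelow f M ℤ.+ f M ≡⟨ cong (λ x → sumBelow f M ℤ.+ x) (vanish M (≤′⇒≤ N≤M)) ⟩
  sumBelow f M ℤ.+ + 0 ≡⟨ ℤₚ.+-identityʳ (sumBelow f M) ⟩
  sumBelow f M         ≡⟨ sumBelow-stable f vanish N≤M ⟩
  sumBelow f N         ∎
  where open ≡-Reasoning

saturated⇒2*defect≡sumBelow-T : ∀ (u : Word k) {C P q} → ClosedUnderReversal u →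
  IsFactorComplexity u C → IsPalComplexity u P → Saturated u q →
  + 2 * defect u q ≡ sumBelow (T C P) (suc q)
saturated⇒2*defect≡sumBelow-T u {C} {P} {q} closed isC isP saturated =
  ∙-cancelˡ ℤₚ.+-0-abelianGroup (+ 2 * s) _ _ (begin
    + 2 * s ℤ.+ + 2 * defect u q
      ≡⟨ cong₂ (λ x y → x ℤ.+ + 2 * y) 2*s≡2*p+c (defect≡1+m-#palindromes u q) ⟩
    + 2 * p ℤ.+ c ℤ.+ + 2 * (l ℤ.- p)
      ≡⟨ cancel p c l ⟩
    c ℤ.+ + 2 * l
      ≡⟨ 2*sumUpTo-P+sumBelow-T C P (C0≡P0 u isC isP) (suc q) ⟨
    + 2 * s ℤ.+ sumBelow (T C P) (suc q) ∎)
  where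
  open ≡-Reasoning
  s p c l : ℤ
  s = + sumUpTo P (suc q)
  p = + #palindromes u q
  c = + (C (suc q) + P (suc q))
  l = + suc q
  2*s≡2*p+c : + 2 * s ≡ + 2 * p ℤ.+ c
  2*s≡2*p+c = begin
    + 2 * s
      ≡⟨ ℤₚ.pos-* 2 (sumUpTo P (suc q)) ⟨
    + (2 ℕ.* sumUpTo P (suc q))
      ≡⟨ cong +_ (2*sumUpTo-P≡2*#palindromes+C+P u closed isC isP saturated) ⟩
    + (2 ℕ.* #palindromes u q) ℤ.+ c
      ≡⟨ cong (ℤ._+ c) (ℤₚ.pos-* 2 (#palindromes u q)) ⟩
    + 2 * p ℤ.+ c ∎
  cancel : ∀ p c l → + 2 * p ℤ.+ c ℤ.+ + 2 * (l ℤ.- p) ≡ c ℤ.+ + 2 * l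
  cancel = ℤ-Solver.solve-∀

theorem1 : (k : ℕ) (u : Word k) (C P : ℕ → ℕ) (d : ℤ) (N : ℕ)
    → ClosedUnderReversal u
    → IsFactorComplexity u C
    → IsPalComplexity u P
    → IsDefect u d
    → (∀ n → n ≥ N → T C P n ≡ + 0)
    → + 2 * d ≡ sumBelow (T C P) N
theorem1 k u C P d N closed isC isP (defect≤d , n₀ , attained) vanish = begin
  + 2 * d                  ≡⟨ cong (+ 2 *_) defect-q≡d ⟨
  + 2 * defect u q         ≡⟨ saturated⇒2*defect≡sumBelow-T u closed isC isP
                                (maximal-defect⇒saturated u defect≤d q defect-q≡d) ⟩
  sumBelow (T C P) (suc q) ≡⟨ sumBelow-stable (T C P) vanish (≤⇒≤′ (m≤n⇒m≤1+n (m≤n⊔m n₀ N))) ⟩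
  sumBelow (T C P) N       ∎
  where
  open ≡-Reasoning
  q : ℕ
  q = n₀ ⊔ N
  defect-q≡d : defect u q ≡ d
  defect-q≡d = maximal-defect-stable u defect≤d attained (≤⇒≤′ (m≤m⊔n n₀ N))
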